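{- Let $\mathcal{S}=\{p_1,\dots,p_n\}\subset \mathbb{R}^d/\mathbb{R}\mathbf{1}$ be any finite collection of points. Then the set of tropical Fermat-Weber points $$\mathrm{FW}(\mathcal{S})=\Big\{x^*\in\mathbb{R}^d/\mathbb{R}\mathbf{1} \;:\; x^*\in\arg\min_x \sum_{i=1}^n d_{\mathrm{tr}}(x,p_i)\Big\}$$ is a polytrope in $\mathbb{R}^d/\mathbb{R}\mathbf{1}$. Moreover, this polytrope is a unique maximal cell of the bi-tropical covector decomposition $\mathrm{BCD}(\mathcal{S})$, i.e. $\mathrm{FW}(\mathcal{S})$ coincides with a single closed cell of $\mathrm{BCD}(\mathcal{S})$.
   Context: $\mathbb{R}^d/\mathbb{R}\mathbf{1}$ is the tropical projective torus, the quotient of $\mathbb{R}^d$ by the line spanned by $\mathbf{1}=(1,\dots,1)$, identified with $\mathbb{R}^{d-1}$ via $x\mapsto(0,x_2-x_1,\dots,x_d-x_1)$. The (symmetric) tropical metric is $d_{\mathrm{tr}}(u,v)=\max_{j\in[d]}(u_j-v_j)-\min_{k\in[d]}(u_k-v_k)$. A subset $P$ is tropically convex if for all $u,v\in P$ and $a,b\in\mathbb{R}$ the componentwise maximum $\max(a+u,b+v)$ lies in $P$; a polytrope is a subset that is both classically convex (in $\mathbb{R}^{d-1}$) and tropically convex. Let $V$ be the $n\times d$ real matrix whose $i$-th row $v_i$ is $p_i$. For $x\in\mathbb{R}^d/\mathbb{R}\mathbf{1}$ define the max covector graph $G_V(x)=\{(i,j): j\in\arg\max_{k}(x_k-v_{ik})\}$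 and the min covector graph $\overline{G}_V(x)=\{(j,i): j\in\arg\min_{k}(x_k-v_{ik})\}$. The bi-tropical covector decomposition $\mathrm{BCD}(\mathcal{S})$ is the polyhedral subdivision of $\mathbb{R}^d/\mathbb{R}\mathbf{1}$ induced by the union of the max-plus tropical hyperplanes and the min-plus tropical hyperplanes with apices $p_1,\dots,p_n$; its closed cells are the sets $C(x)=\{y: x_\cdot \text{ replaced by } y \text{ satisfies } y_j-y_k\ge v_{ij}-v_{ik}\ \forall (i,j)\in G_V(x),k\in[d];\ y_j-y_k\le v_{ij}-v_{ik}\ \forall (j,i)\in\overline{G}_V(x),k\in[d]\}$, equivalently $C(x)=\{y: G_V(y)\supseteq G_V(x),\ \overline{G}_V(y)\supseteq\overline{G}_V(x)\}$, for $x\in\mathbb{R}^d/\mathbb{R}\mathbf{1}$. -}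

module Defs where

open import Level using (0ℓ)
open import Data.Nat using (ℕ; suc)
open import Data.Fin using (Fin; zero)
open import Data.Product using (Σ; ∃; _×_; _,_)
open import Data.Empty using (⊥)
open import Relation.Nullary using (¬_; yes; no)
open import Relation.Binary.PropositionalEquality using (_≡_)
open import Relation.Binary.Structures using (IsDecTotalOrder)
open import Algebra.Structures using (IsCommutativeRing)

-- An ordered field (e.g. ℝ); the paper's statement is about ℝ, and we
-- state it for every ordered field, which includes ℝ.
record OrderedField : Set₁ where
  infixl 6 _+_ _-_
  infixl 7 _*_
  infix 4 _≤_
  field
    Carrier : Set
    0# 1#   : Carrier
    _+_ _*_ : Carrier → Carrier → Carrier
    -_      : Carrier → Carrier
    _≤_     : Carrier → Carrier → Set
    isCommutativeRing : IsCommutativeRing _≡_ _+_ _*_ -_ 0# 1#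
    0≢1     : ¬ (0# ≡ 1#)
    inverse : ∀ x → ¬ (x ≡ 0#) → Σ Carrier (λ y → x * y ≡ 1#)
    isDecTotalOrder : IsDecTotalOrder _≡_ _≤_
    +-mono-≤ : ∀ {x y} z → x ≤ y → x + z ≤ y + z
    *-nonneg : ∀ {x y} → 0# ≤ x → 0# ≤ y → 0# ≤ x * y

  _-_ : Carrier → Carrier → Carrier
  x - y = x + (- y)

  open IsDecTotalOrder isDecTotalOrder public using (_≤?_)

  max min : Carrier → Carrier → Carrier
  max x y with x ≤? y
  ... | yes _ = y
  ... | no  _ = x
  min x y with x ≤? y
  ... | yes _ = x
  ... | no  _ = y

module TropicalDefs (F : OrderedField) where
  open OrderedField F

  -- points of ℝ^d, d = suc m (d ≥ 1); a point of the tropical projective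
  -- torus ℝ^d/ℝ1 is represented by any of its representatives.
  Pt : ℕ → Set
  Pt m = Fin (suc m) → Carrier

  maxOver : ∀ {k} → (Fin (suc k) → Carrier) → Carrier
  maxOver {ℕ.zero} f = f zero
  maxOver {suc k} f = max (f zero) (maxOver (λ j → f (Fin.suc j)))

  minOver : ∀ {k} → (Fin (suc k) → Carrier) → Carrier
  minOver {ℕ.zero} f = f zero
  minOver {suc k} f = min (f zero) (minOver (λ j → f (Fin.suc j)))

  sumOver : ∀ {n} → (Fin n → Carrier) → Carrier
  sumOver {ℕ.zero} f = 0#
  sumOver {suc n} f = f zero + sumOver (λ i → f (Fin.suc i))

  dtr : ∀ {m} → Pt m → Pt m → Carrier
  dtr u v = maxOver (λ j → u j - v j) - minOver (λ k → u k - v k)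

  -- subsets of ℝ^d/ℝ1, as predicates on representatives
  Subset : ℕ → Set₁
  Subset m = Pt m → Set

  FW : ∀ {n m} → (Fin n → Pt m) → Subset m
  FW p x = ∀ y → sumOver (λ i → dtr x (p i)) ≤ sumOver (λ i → dtr y (p i))

  tmax : ∀ {m} → Carrier → Pt m → Carrier → Pt m → Pt m
  tmax a u b v j = max (a + u j) (b + v j)

  IsTropicallyConvex : ∀ {m} → Subset m → Set
  IsTropicallyConvex P = ∀ u v → P u → P v → ∀ a b → P (tmax a u b v)

  -- normal form x ↦ (0, x_2 - x_1, …, x_d - x_1) identifying ℝ^d/ℝ1 with ℝ^{d-1}
  normalize : ∀ {m} → Pt m → Pt m
  normalize x j = x j - x zero

  IsClassicallyConvex : ∀ {m} → Subset m → Set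
  IsClassicallyConvex P = ∀ u v → P u → P v → ∀ t → 0# ≤ t → t ≤ 1# →
    P (λ j → t * normalize u j + (1# - t) * normalize v j)

  IsPolytrope : ∀ {m} → Subset m → Set
  IsPolytrope P = IsClassicallyConvex P × IsTropicallyConvex P

  InG : ∀ {n m} → (Fin n → Pt m) → Pt m → Fin n → Fin (suc m) → Set
  InG V x i j = ∀ k → x k - V i k ≤ x j - V i j

  InGbar : ∀ {n m} → (Fin n → Pt m) → Pt m → Fin (suc m) → Fin n → Set
  InGbar V x j i = ∀ k → x j - V i j ≤ x k - V i k

  Cell : ∀ {n m} → (Fin n → Pt m) → Pt m → Subset m
  Cell V x y =
    (∀ i j → InG V x i j → ∀ k → V i j - V i k ≤ y j - y k) ×
    (∀ j i → InGbar V x j i → ∀ k → y j - y k ≤ V i j - V i k)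

-- The cost Σᵢ dtr y pᵢ is a maximum of finitely many affine forms, so Fourier–Motzkin elimination shows that its
-- minimum is attained over any ordered field. On FW the cost is constant and each convex summand is affine; hence a
-- linear form of a summand that is maximal at a relative interior point x of FW is maximal on all of FW, and FW lies
-- in the cell of x. Conversely, for y in that cell the cost is affine on the segment from y to x and slightly beyond,
-- so minimality at x forces it to be constant there. A cell is cut out by bounds on coordinate differences, and
-- these are preserved by classical and tropical convex combinations.
module Submission where

open import Defs
open import Level using (0ℓ)
open import Algebra using (CommutativeRing; RawRing)
open import Algebra.Solver.Ring.AlmostCommutativeRing using (_-Raw-AlmostCommutative⟶_; fromCommutativeRing)
open import Data.Nat as ℕ using (ℕ; zero; suc)
open import Data.Fin using (Fin; zero; suc)
open import Data.List using (List; []; _∷_; _++_; map; filter; cartesianProduct; cartesianProductWith; allFin)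
open import Data.List.Membership.Propositional using (_∈_)
open import Data.List.Membership.Propositional.Properties
open import Data.List.Relation.Unary.All as All using (All; []; _∷_)
open import Data.List.Relation.Unary.Any using (here; there)
open import Data.Maybe as Maybe using (Maybe)
open import Data.Product using (Σ; ∃; ∃₂; _×_; _,_; proj₁; proj₂)
open import Data.Product.Properties using (≡-dec)
open import Data.Sum using (_⊎_; inj₁; inj₂; [_,_]′)
open import Data.Vec.Functional using () renaming (_∷_ to _◂_)
open import Function.Base using (_∘_)
open import Function.Bundles using (_⇔_; mk⇔; Equivalence)
open import Relation.Binary.PropositionalEquality
open import Relation.Binary.Structures using (IsDecTotalOrder)
open import Relation.Nullary using (¬_; Dec; yes; no; contradiction)
open import Relation.Nullary.Decidable using (¬?; dec⇒maybe)
import Algebra.Properties.CommutativeSemigroup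
import Algebra.Properties.Ring
import Algebra.Properties.Semiring.Mult.TCOptimised
import Algebra.Solver.Ring

-- Integer coefficients let the ring solver cancel. The integer m − n is the pair (m , n), and the case split in ⟦_⟧
-- keeps the literals 0 and 1 definitional.
module DifferenceCoefficients (F : OrderedField) where
  open OrderedField F using (Carrier; isCommutativeRing)

  commutativeRing : CommutativeRing 0ℓ 0ℓ
  commutativeRing = record { isCommutativeRing = isCommutativeRing }

  open CommutativeRing commutativeRing hiding (Carrier; sym; trans; refl; zero)
  open Algebra.Properties.Ring ring
  open Algebra.Properties.CommutativeSemigroup +-commutativeSemigroup
  open Algebra.Properties.Semiring.Mult.TCOptimised semiring
    renaming (_×_ to _·_)
  open ≡-Reasoning

  ⟦_⟧ : ℕ × ℕ → Carrier
  ⟦ m , zero ⟧  = m · 1#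
  ⟦ m , suc n ⟧ = m · 1# - suc n · 1#

  ⟦⟧-difference : ∀ m n → ⟦ m , n ⟧ ≡ m · 1# - n · 1#
  ⟦⟧-difference m zero    = sym (trans (cong (m · 1# +_) -0#≈0#) (+-identityʳ _))
  ⟦⟧-difference m (suc n) = refl

  -+-interchange : ∀ a b c d → (a + c) - (b + d) ≡ (a - b) + (c - d)
  -+-interchange a b c d = trans (cong ((a + c) +_) (sym (-‿+-comm b d))) (interchange a c (- b) (- d))

  -*-expand : ∀ a b c d → (a * c + b * d) - (a * d + b * c) ≡ (a - b) * (c - d)
  -*-expand a b c d = begin
    (a * c + b * d) - (a * d + b * c)     ≡⟨ -+-interchange _ _ _ _ ⟩
    (a * c - a * d) + (b * d - b * c)     ≡⟨ cong₂ _+_ (sym (x[y-z]≈xy-xz a c d)) (sym (⁻¹-anti-homo‿- (b * c) (b * d))) ⟩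
    a * (c - d) - (b * c - b * d)         ≡⟨ cong (λ z → a * (c - d) - z) (sym (x[y-z]≈xy-xz b c d)) ⟩
    a * (c - d) - b * (c - d)             ≡⟨ sym ([y-z]x≈yx-zx (c - d) a b) ⟩
    (a - b) * (c - d) ∎

  -- Cancelling the common part leaves one component zero, so every integer has a single reduced
  -- pair and `_≟_` may compare pairs componentwise.
  reduce : ℕ → ℕ → ℕ × ℕ
  reduce (suc m) (suc n) = reduce m n
  reduce m       n       = m , n

  ⟦reduce⟧ : ∀ m n → ⟦ reduce m n ⟧ ≡ m · 1# - n · 1#
  ⟦reduce⟧ zero    n       = ⟦⟧-difference zero n
  ⟦reduce⟧ (suc m) zero    = ⟦⟧-difference (suc m) zero
  ⟦reduce⟧ (suc m) (suc n) = begin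
    ⟦ reduce m n ⟧                       ≡⟨ ⟦reduce⟧ m n ⟩
    m · 1# - n · 1#                      ≡⟨ sym (+-identityˡ _) ⟩
    0# + (m · 1# - n · 1#)               ≡⟨ cong (_+ (m · 1# - n · 1#)) (sym (-‿inverseʳ 1#)) ⟩
    (1# - 1#) + (m · 1# - n · 1#)        ≡⟨ sym (-+-interchange _ _ _ _) ⟩
    (1# + m · 1#) - (1# + n · 1#)        ≡⟨ sym (cong₂ _-_ (1+× m 1#) (1+× n 1#)) ⟩
    suc m · 1# - suc n · 1# ∎

  coefficients : RawRing 0ℓ 0ℓ
  coefficients = record
    { Carrier = ℕ × ℕ
    ; _≈_     = _≡_
    ; _+_     = λ (a , b) (c , d) → reduce (a ℕ.+ c) (b ℕ.+ d)
    ; _*_     = λ (a , b) (c , d) → reduce (a ℕ.* c ℕ.+ b ℕ.* d) (a ℕ.* d ℕ.+ b ℕ.* c)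
    ; -_      = λ (a , b) → b , a
    ; 0#      = 0 , 0
    ; 1#      = 1 , 0
    }

  morphism : coefficients -Raw-AlmostCommutative⟶ fromCommutativeRing commutativeRing
  morphism = record
    { ⟦_⟧    = ⟦_⟧
    ; +-homo = λ (a , b) (c , d) → begin
        ⟦ reduce (a ℕ.+ c) (b ℕ.+ d) ⟧                  ≡⟨ ⟦reduce⟧ (a ℕ.+ c) (b ℕ.+ d) ⟩
        (a ℕ.+ c) · 1# - (b ℕ.+ d) · 1#                 ≡⟨ cong₂ _-_ (×-homo-+ 1# a c) (×-homo-+ 1# b d) ⟩
        (a · 1# + c · 1#) - (b · 1# + d · 1#)           ≡⟨ -+-interchange _ _ _ _ ⟩
        (a · 1# - b · 1#) + (c · 1# - d · 1#)           ≡⟨ sym (cong₂ _+_ (⟦⟧-difference a b) (⟦⟧-difference c d)) ⟩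
        ⟦ a , b ⟧ + ⟦ c , d ⟧ ∎
    ; *-homo = λ (a , b) (c , d) → begin
        ⟦ reduce (a ℕ.* c ℕ.+ b ℕ.* d) (a ℕ.* d ℕ.+ b ℕ.* c) ⟧   ≡⟨ ⟦reduce⟧ (a ℕ.* c ℕ.+ b ℕ.* d) (a ℕ.* d ℕ.+ b ℕ.* c) ⟩
        (a ℕ.* c ℕ.+ b ℕ.* d) · 1# - (a ℕ.* d ℕ.+ b ℕ.* c) · 1#
          ≡⟨ cong₂ _-_ (·-homo a c b d) (·-homo a d b c) ⟩
        (a · 1# * c · 1# + b · 1# * d · 1#) - (a · 1# * d · 1# + b · 1# * c · 1#)
          ≡⟨ -*-expand _ _ _ _ ⟩
        (a · 1# - b · 1#) * (c · 1# - d · 1#)           ≡⟨ sym (cong₂ _*_ (⟦⟧-difference a b) (⟦⟧-difference c d)) ⟩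
        ⟦ a , b ⟧ * ⟦ c , d ⟧ ∎
    ; -‿homo = λ (a , b) → begin
        ⟦ b , a ⟧              ≡⟨ ⟦⟧-difference b a ⟩
        b · 1# - a · 1#        ≡⟨ sym (⁻¹-anti-homo‿- (a · 1#) (b · 1#)) ⟩
        - (a · 1# - b · 1#)    ≡⟨ sym (cong -_ (⟦⟧-difference a b)) ⟩
        - ⟦ a , b ⟧ ∎
    ; 0-homo = refl
    ; 1-homo = refl
    }
    where
    ·-homo : ∀ a c b d → (a ℕ.* c ℕ.+ b ℕ.* d) · 1# ≡ a · 1# * c · 1# + b · 1# * d · 1#
    ·-homo a c b d = trans (×-homo-+ 1# (a ℕ.* c) (b ℕ.* d)) (cong₂ _+_ (×1-homo-* a c) (×1-homo-* b d))

  _≟_ : ∀ p q → Maybe (⟦ p ⟧ ≡ ⟦ q ⟧)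
  p ≟ q = Maybe.map (cong ⟦_⟧) (dec⇒maybe (≡-dec ℕ._≟_ ℕ._≟_ p q))

-- Inequalities, inverses, maxima and minima in an ordered field.

module OrderedFieldProperties (F : OrderedField) where
  open OrderedField F public
  open DifferenceCoefficients F using (commutativeRing; morphism; _≟_)
  open CommutativeRing commutativeRing public
    using (+-identityˡ; +-identityʳ; *-identityˡ; *-identityʳ; zeroˡ; zeroʳ; -‿inverseʳ; *-comm)
  open IsDecTotalOrder isDecTotalOrder public using (total; antisym)
    renaming (refl to ≤-refl; trans to ≤-trans; reflexive to ≤-reflexive; _≟_ to _≟#_)
  module Solver = Algebra.Solver.Ring _ _ morphism _≟_
  open Solver public using (solve; con; _:=_; _:+_; _:*_; _:-_; :-_)

  infix 4 _<_
  _<_ : Carrier → Carrier → Set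
  x < y = ¬ (y ≤ x)

  <⇒≤ : ∀ {x y} → x < y → x ≤ y
  <⇒≤ {x} {y} y≰x with total x y
  ... | inj₁ x≤y = x≤y
  ... | inj₂ y≤x = contradiction y≤x y≰x

  x≤y⇒0≤y-x : ∀ {x y} → x ≤ y → 0# ≤ y - x
  x≤y⇒0≤y-x {x} {y} x≤y = subst (_≤ y - x) (-‿inverseʳ x) (+-mono-≤ (- x) x≤y)

  -- Inequalities are proved by exhibiting the difference of the two sides as a visibly nonnegative expression.
  ≤-by-difference : ∀ {x y e} → 0# ≤ e → e ≡ y - x → x ≤ y
  ≤-by-difference {x} {y} {e} 0≤e e≡y-x =
    subst₂ _≤_ (+-identityˡ x) (trans (cong (_+ x) e≡y-x) (solve 2 (λ x y → y :- x :+ x := y) refl x y)) (+-mono-≤ x 0≤e)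

  0≤y-x⇒x≤y : ∀ {x y} → 0# ≤ y - x → x ≤ y
  0≤y-x⇒x≤y 0≤y-x = ≤-by-difference 0≤y-x refl

  +-nonneg : ∀ {x y} → 0# ≤ x → 0# ≤ y → 0# ≤ x + y
  +-nonneg {x} {y} 0≤x 0≤y = ≤-trans 0≤y (≤-by-difference 0≤x (solve 2 (λ x y → x := x :+ y :- y) refl x y))

  +-mono₂-≤ : ∀ {x y u v} → x ≤ y → u ≤ v → x + u ≤ y + v
  +-mono₂-≤ {x} {y} {u} {v} x≤y u≤v = ≤-by-difference (+-nonneg (x≤y⇒0≤y-x x≤y) (x≤y⇒0≤y-x u≤v))
    (solve 4 (λ x y u v → (y :- x) :+ (v :- u) := (y :+ v) :- (x :+ u)) refl x y u v)

  *-monoˡ-≤ : ∀ {c x y} → 0# ≤ c → x ≤ y → c * x ≤ c * y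
  *-monoˡ-≤ {c} {x} {y} 0≤c x≤y = ≤-by-difference (*-nonneg 0≤c (x≤y⇒0≤y-x x≤y))
    (solve 3 (λ c x y → c :* (y :- x) := c :* y :- c :* x) refl c x y)

  neg-nonneg : ∀ {x} → x ≤ 0# → 0# ≤ - x
  neg-nonneg {x} x≤0 = ≤-trans (x≤y⇒0≤y-x x≤0) (≤-reflexive (+-identityˡ (- x)))

  neg-pos : ∀ {x} → x < 0# → 0# < - x
  neg-pos {x} x<0 -x≤0 = x<0 (≤-by-difference (neg-nonneg -x≤0) (solve 1 (λ x → :- (:- x) := x :- con (0 , 0)) refl x))

  0≤1 : 0# ≤ 1#
  0≤1 with total 0# 1#
  ... | inj₁ 0≤1 = 0≤1
  -- Here -1 is nonnegative, and its square is 1.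
  ... | inj₂ 1≤0 = ≤-trans (*-nonneg (neg-nonneg 1≤0) (neg-nonneg 1≤0))
    (≤-reflexive (solve 0 (:- con (1 , 0) :* :- con (1 , 0) := con (1 , 0)) refl))

  0<1 : 0# < 1#
  0<1 1≤0 = 0≢1 (antisym 0≤1 1≤0)

  0≰-1 : ¬ (0# ≤ - 1#)
  0≰-1 0≤-1 = 0<1 (≤-by-difference 0≤-1 (solve 0 (:- con (1 , 0) := con (0 , 0) :- con (1 , 0)) refl))

  0<⇒≢0 : ∀ {x} → 0# < x → ¬ (x ≡ 0#)
  0<⇒≢0 0<x x≡0 = 0<x (≤-reflexive x≡0)

  <0⇒≢0 : ∀ {x} → x < 0# → ¬ (x ≡ 0#)
  <0⇒≢0 x<0 x≡0 = x<0 (≤-reflexive (sym x≡0))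

  -- Made total by the value `0#` at `0#`, so that quotients such as `root` can be written without a
  -- proof that the divisor is nonzero.
  inv : Carrier → Carrier
  inv x with x ≟# 0#
  ... | yes _   = 0#
  ... | no  x≢0 = proj₁ (inverse x x≢0)

  *-inv : ∀ {x} → ¬ (x ≡ 0#) → x * inv x ≡ 1#
  *-inv {x} x≢0 with x ≟# 0#
  ... | yes x≡0 = contradiction x≡0 x≢0
  ... | no  x≢0 = proj₂ (inverse x x≢0)

  inv-pos : ∀ {x} → 0# < x → 0# < inv x
  inv-pos {x} 0<x inv≤0 = 0≰-1 (≤-trans (*-nonneg (<⇒≤ 0<x) (neg-nonneg inv≤0)) (≤-reflexive
    (trans (solve 2 (λ x y → x :* :- y := :- (x :* y)) refl x (inv x)) (cong -_ (*-inv (0<⇒≢0 0<x))))))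

  *-cancel-nonneg : ∀ {c x} → 0# < c → 0# ≤ c * x → 0# ≤ x
  *-cancel-nonneg {c} {x} 0<c 0≤cx = ≤-trans (*-nonneg (<⇒≤ (inv-pos 0<c)) 0≤cx) (≤-reflexive
    (trans (solve 3 (λ c i x → i :* (c :* x) := (c :* i) :* x) refl c (inv c) x)
      (trans (cong (_* x) (*-inv (0<⇒≢0 0<c))) (*-identityˡ x))))

  *-cancelˡ-≤ : ∀ {c x y} → 0# < c → c * x ≤ c * y → x ≤ y
  *-cancelˡ-≤ {c} {x} {y} 0<c cx≤cy = 0≤y-x⇒x≤y (*-cancel-nonneg 0<c (≤-trans (x≤y⇒0≤y-x cx≤cy)
    (≤-reflexive (solve 3 (λ c x y → c :* y :- c :* x := c :* (y :- x)) refl c x y))))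

  0<2 : 0# < 1# + 1#
  0<2 2≤0 = 0≰-1 (≤-by-difference (+-nonneg (neg-nonneg 2≤0) 0≤1)
    (solve 0 (:- (con (1 , 0) :+ con (1 , 0)) :+ con (1 , 0) := :- con (1 , 0) :- con (0 , 0)) refl))

  ½ : Carrier
  ½ = inv (1# + 1#)

  0<½ : 0# < ½
  0<½ = inv-pos 0<2

  1-½≡½ : 1# - ½ ≡ ½
  1-½≡½ = trans (cong (_- ½) (sym (*-inv (0<⇒≢0 0<2))))
    (solve 1 (λ h → (con (1 , 0) :+ con (1 , 0)) :* h :- h := h) refl ½)

  x≤max : ∀ x y → x ≤ max x y
  x≤max x y with x ≤? y
  ... | yes x≤y = x≤y
  ... | no  _   = ≤-refl

  y≤max : ∀ x y → y ≤ max x y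
  y≤max x y with x ≤? y
  ... | yes _ = ≤-refl
  ... | no x≰y = <⇒≤ x≰y

  max-sel : ∀ (P : Carrier → Set) x y → P (max x y) → P x ⊎ P y
  max-sel P x y p with x ≤? y
  ... | yes _ = inj₂ p
  ... | no  _ = inj₁ p

  max-lub : ∀ {x y z} → x ≤ z → y ≤ z → max x y ≤ z
  max-lub {x} {y} x≤z y≤z with x ≤? y
  ... | yes _ = y≤z
  ... | no  _ = x≤z

  min≤x : ∀ x y → min x y ≤ x
  min≤x x y with x ≤? y
  ... | yes _  = ≤-refl
  ... | no x≰y = <⇒≤ x≰y

  min≤y : ∀ x y → min x y ≤ y
  min≤y x y with x ≤? y
  ... | yes x≤y = x≤y
  ... | no  _   = ≤-refl

  min-glb : ∀ {x y z} → z ≤ x → z ≤ y → z ≤ min x y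
  min-glb {x} {y} z≤x z≤y with x ≤? y
  ... | yes _ = z≤x
  ... | no  _ = z≤y

  min-pos : ∀ {x y} → 0# < x → 0# < y → 0# < min x y
  min-pos {x} {y} 0<x 0<y with x ≤? y
  ... | yes _ = 0<x
  ... | no  _ = 0<y

-- Linear programming by Fourier-Motzkin elimination.

module LinearProgramming (F : OrderedField) where
  open OrderedFieldProperties F

  -- Affine forms in k eliminable variables x and one parameter t, which serves as the objective.
  data Affine : ℕ → Set where
    base : Carrier → Carrier → Affine zero
    _▹_  : ∀ {k} → Carrier → Affine k → Affine (suc k)

  -- At `base` this is the coefficient of the parameter, so the same sign filters serve both the
  -- elimination steps and the final problem in t alone.
  leading : ∀ {k} → Affine k → Carrier
  leading (base α _) = α
  leading (a ▹ _)    = a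

  rest : ∀ {k} → Affine (suc k) → Affine k
  rest (_ ▹ l) = l

  eval : ∀ {k} → Affine k → (Fin k → Carrier) → Carrier → Carrier
  eval (base α β) x t = α * t + β
  eval (a ▹ l) x t = a * x zero + eval l (x ∘ suc) t

  combine : ∀ {k} → Carrier → Affine k → Carrier → Affine k → Affine k
  combine c (base α β) d (base α′ β′) = base (c * α + d * α′) (c * β + d * β′)
  combine c (a ▹ l) d (b ▹ m)   = (c * a + d * b) ▹ combine c l d m

  eval-combine : ∀ {k} c (l : Affine k) d m x t →
    eval (combine c l d m) x t ≡ c * eval l x t + d * eval m x t
  eval-combine c (base α β) d (base α′ β′) x t =
    solve 7 (λ c α β d α′ β′ t → (c :* α :+ d :* α′) :* t :+ (c :* β :+ d :* β′) :=
      c :* (α :* t :+ β) :+ d :* (α′ :* t :+ β′)) refl c α β d α′ β′ t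
  eval-combine c (a ▹ l) d (b ▹ m) x t = trans
    (cong ((c * a + d * b) * x zero +_) (eval-combine c l d m (x ∘ suc) t))
    (solve 7 (λ c a u d b v x → (c :* a :+ d :* b) :* x :+ (c :* u :+ d :* v) :=
      c :* (a :* x :+ u) :+ d :* (b :* x :+ v)) refl c a (eval l (x ∘ suc) t) d b (eval m (x ∘ suc) t) (x zero))

  infixl 6 _⊕_ _⊖_
  _⊕_ _⊖_ : ∀ {k} → Affine k → Affine k → Affine k
  l ⊕ m = combine 1# l 1# m
  l ⊖ m = combine 1# l (- 1#) m

  eval-⊕ : ∀ {k} (l m : Affine k) x t → eval (l ⊕ m) x t ≡ eval l x t + eval m x t
  eval-⊕ l m x t = trans (eval-combine 1# l 1# m x t) (cong₂ _+_ (*-identityˡ _) (*-identityˡ _))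

  eval-⊖ : ∀ {k} (l m : Affine k) x t → eval (l ⊖ m) x t ≡ eval l x t - eval m x t
  eval-⊖ l m x t = trans (eval-combine 1# l (- 1#) m x t)
    (solve 2 (λ a b → con (1 , 0) :* a :+ :- con (1 , 0) :* b := a :- b) refl (eval l x t) (eval m x t))

  affine₀ : ∀ {k} → Carrier → Carrier → Affine k
  affine₀ {zero}  α β = base α β
  affine₀ {suc k} α β = 0# ▹ affine₀ α β

  eval-affine₀ : ∀ {k} α β (x : Fin k → Carrier) t → eval (affine₀ α β) x t ≡ α * t + β
  eval-affine₀ {zero}  α β x t = refl
  eval-affine₀ {suc k} α β x t = trans (cong₂ _+_ (zeroˡ (x zero)) (eval-affine₀ α β (x ∘ suc) t)) (+-identityˡ _)

  constant : ∀ {k} → Carrier → Affine k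
  constant = affine₀ 0#

  parameter : ∀ {k} → Affine k
  parameter = affine₀ 1# 0#

  coordinate : ∀ {k} → Fin k → Affine k
  coordinate zero    = 1# ▹ constant 0#
  coordinate (suc j) = 0# ▹ coordinate j

  eval-constant : ∀ {k} c (x : Fin k → Carrier) t → eval (constant c) x t ≡ c
  eval-constant c x t = trans (eval-affine₀ 0# c x t) (solve 2 (λ c t → con (0 , 0) :* t :+ c := c) refl c t)

  eval-parameter : ∀ {k} (x : Fin k → Carrier) t → eval parameter x t ≡ t
  eval-parameter x t = trans (eval-affine₀ 1# 0# x t) (solve 1 (λ t → con (1 , 0) :* t :+ con (0 , 0) := t) refl t)

  eval-coordinate : ∀ {k} j (x : Fin k → Carrier) t → eval (coordinate j) x t ≡ x j
  eval-coordinate zero    x t = trans (cong (1# * x zero +_) (eval-constant 0# (x ∘ suc) t))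
    (trans (+-identityʳ _) (*-identityˡ _))
  eval-coordinate (suc j) x t = trans (cong₂ _+_ (zeroˡ (x zero)) (eval-coordinate j (x ∘ suc) t)) (+-identityˡ _)

  Satisfies : ∀ {k} → List (Affine k) → (Fin k → Carrier) → Carrier → Set
  Satisfies L x t = ∀ l → l ∈ L → 0# ≤ eval l x t

  positive? : ∀ {k} (l : Affine k) → Dec (0# < leading l)
  positive? l = ¬? (leading l ≤? 0#)

  negative? : ∀ {k} (l : Affine k) → Dec (leading l < 0#)
  negative? l = ¬? (0# ≤? leading l)

  zero? : ∀ {k} (l : Affine k) → Dec (leading l ≡ 0#)
  zero? l = leading l ≟# 0#

  data Sign (a : Carrier) : Set where
    pos  : 0# < a → Sign a
    neg  : a < 0# → Sign a
    null : a ≡ 0# → Sign a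

  sign : ∀ a → Sign a
  sign a with a ≤? 0# | 0# ≤? a
  ... | no  0<a | _       = pos 0<a
  ... | yes _   | no  a<0 = neg a<0
  ... | yes a≤0 | yes 0≤a = null (antisym a≤0 0≤a)

  -- The zero of τ ↦ a * τ + b when `a` is nonzero.
  root : Carrier → Carrier → Carrier
  root a b = - (b * inv a)

  factor : ∀ {a} b τ → ¬ (a ≡ 0#) → a * (τ - root a b) ≡ a * τ + b
  factor {a} b τ a≢0 = trans
    (solve 4 (λ a b i τ → a :* (τ :- :- (b :* i)) := a :* τ :+ b :* (a :* i)) refl a b (inv a) τ)
    (cong (a * τ +_) (trans (cong (b *_) (*-inv a≢0)) (*-identityʳ b)))

  factor-neg : ∀ {a} b τ → ¬ (a ≡ 0#) → - a * (root a b - τ) ≡ a * τ + b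
  factor-neg {a} b τ a≢0 = trans
    (solve 3 (λ a r τ → :- a :* (r :- τ) := a :* (τ :- r)) refl a (root a b) τ) (factor b τ a≢0)

  root≤ : ∀ {a b τ} → 0# < a → 0# ≤ a * τ + b → root a b ≤ τ
  root≤ {a} {b} {τ} 0<a 0≤aτ+b = 0≤y-x⇒x≤y (*-cancel-nonneg 0<a
    (≤-trans 0≤aτ+b (≤-reflexive (sym (factor b τ (0<⇒≢0 0<a))))))

  above-root : ∀ {a b τ} → 0# < a → root a b ≤ τ → 0# ≤ a * τ + b
  above-root {a} {b} {τ} 0<a r≤τ = ≤-trans (*-nonneg (<⇒≤ 0<a) (x≤y⇒0≤y-x r≤τ)) (≤-reflexive (factor b τ (0<⇒≢0 0<a)))

  below-root : ∀ {a b τ} → a < 0# → τ ≤ root a b → 0# ≤ a * τ + b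
  below-root {a} {b} {τ} a<0 τ≤r = ≤-trans (*-nonneg (<⇒≤ (neg-pos a<0)) (x≤y⇒0≤y-x τ≤r))
    (≤-reflexive (factor-neg b τ (<0⇒≢0 a<0)))

  -- In the combination with multipliers `a` and `- b` the first variable cancels. For `a` positive
  -- and `b` negative both multipliers are positive, so the result follows from the two constraints.
  cross : ∀ {k} → Affine (suc k) → Affine (suc k) → Affine k
  cross (a ▹ l) (b ▹ m) = combine a m (- b) l

  eliminate : ∀ {k} → List (Affine (suc k)) → List (Affine k)
  eliminate L = map rest (filter zero? L) ++ cartesianProductWith cross (filter positive? L) (filter negative? L)

  eliminate-sound : ∀ {k} (L : List (Affine (suc k))) x t → Satisfies L x t → Satisfies (eliminate L) (x ∘ suc) t
  eliminate-sound L x t sat _ l∈ with ∈-++⁻ (map rest (filter zero? L)) l∈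
  ... | inj₁ l∈zeros with (a ▹ l) , al∈ , refl ← ∈-map⁻ rest l∈zeros
                     with al∈L , a≡0 ← ∈-filter⁻ zero? {xs = L} al∈ =
    ≤-trans (sat (a ▹ l) al∈L) (≤-reflexive (trans
      (cong (λ z → z * x zero + eval l (x ∘ suc) t) a≡0) (trans (cong (_+ eval l (x ∘ suc) t) (zeroˡ _)) (+-identityˡ _))))
  ... | inj₂ l∈pairs with (a ▹ l) , (b ▹ m) , al∈ , bm∈ , refl ← ∈-cartesianProductWith⁻ cross (filter positive? L) (filter negative? L) l∈pairs
                     with al∈L , 0<a ← ∈-filter⁻ positive? {xs = L} al∈ | bm∈L , b<0 ← ∈-filter⁻ negative? {xs = L} bm∈ =
    ≤-trans (+-nonneg (*-nonneg (<⇒≤ 0<a) (sat _ bm∈L)) (*-nonneg (<⇒≤ (neg-pos b<0)) (sat _ al∈L)))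
      (≤-reflexive (trans
        (solve 5 (λ a b x u v → a :* (b :* x :+ v) :+ :- b :* (a :* x :+ u) := a :* v :+ :- b :* u) refl
          a b (x zero) (eval l (x ∘ suc) t) (eval m (x ∘ suc) t))
        (sym (eval-combine a m (- b) l (x ∘ suc) t))))

  -- The witness starts from the minimum of `B` and `0#` and then takes the maximum with each
  -- element of `A`; the hypothesis keeps each of these maxima below `B`.
  separate : ∀ A B → (∀ a b → a ∈ A → b ∈ B → a ≤ b) → ∃ λ τ → (∀ a → a ∈ A → a ≤ τ) × (∀ b → b ∈ B → τ ≤ b)
  separate [] [] A≤B = 0# , (λ _ ()) , (λ _ ())
  separate [] (b ∷ B) A≤B with τ , _ , τ≤B ← separate [] B (λ _ _ ()) =
    min τ b , (λ _ ()) , λ where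
      _ (here refl) → min≤y τ b
      c (there c∈B) → ≤-trans (min≤x τ b) (τ≤B c c∈B)
  separate (a ∷ A) B A≤B with τ , A≤τ , τ≤B ← separate A B (λ a b → A≤B a b ∘ there) =
    max τ a , (λ where
      _ (here refl) → y≤max τ a
      c (there c∈A) → ≤-trans (A≤τ c c∈A) (x≤max τ a)) ,
    λ b b∈B → max-lub (τ≤B b b∈B) (A≤B a b (here refl) b∈B)

  -- With the other variables fixed, a constraint with positive leading coefficient bounds the
  -- eliminated variable below by its root, and one with negative leading coefficient bounds it
  -- above. The crossed constraints say that no lower bound exceeds an upper bound, so a separating
  -- value exists.
  eliminate-complete : ∀ {k} (L : List (Affine (suc k))) x t → Satisfies (eliminate L) x t → ∃ λ τ → Satisfies L (τ ◂ x) t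
  eliminate-complete L x t sat = τ , λ { (a ▹ l) al∈L → at-τ a l al∈L (sign a) }
    where
    rootOf : Affine _ → Carrier
    rootOf (a ▹ l) = root a (eval l x t)

    lower upper : List Carrier
    lower = map rootOf (filter positive? L)
    upper = map rootOf (filter negative? L)

    lower≤upper : ∀ r s → r ∈ lower → s ∈ upper → r ≤ s
    lower≤upper _ _ r∈ s∈
      with (a ▹ l) , al∈ , refl ← ∈-map⁻ rootOf r∈ | (b ▹ m) , bm∈ , refl ← ∈-map⁻ rootOf s∈
      with _ , 0<a ← ∈-filter⁻ positive? {xs = L} al∈ | _ , b<0 ← ∈-filter⁻ negative? {xs = L} bm∈ =
      -- For the roots r and s the crossed form equals - b * (a * (s - r)), as `factor` and
      -- `factor-neg` at τ = 0 show; the positive factors are then cancelled.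
      0≤y-x⇒x≤y (*-cancel-nonneg 0<a (*-cancel-nonneg (neg-pos b<0) (≤-trans
        (sat _ (∈-++⁺ʳ (map rest (filter zero? L)) (∈-cartesianProductWith⁺ cross al∈ bm∈)))
        (≤-reflexive (trans (eval-combine a m (- b) l x t) (trans
          (cong₂ (λ v u → a * v + - b * u)
            (sym (trans (factor-neg (eval m x t) 0# (<0⇒≢0 b<0)) (trans (cong (_+ eval m x t) (zeroʳ b)) (+-identityˡ _))))
            (sym (trans (factor (eval l x t) 0# (0<⇒≢0 0<a)) (trans (cong (_+ eval l x t) (zeroʳ a)) (+-identityˡ _)))))
          (solve 4 (λ a b r s → a :* (:- b :* (s :- con (0 , 0))) :+ :- b :* (a :* (con (0 , 0) :- r)) := :- b :* (a :* (s :- r)))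
            refl a b (root a (eval l x t)) (root b (eval m x t)))))))))

    τ = proj₁ (separate lower upper lower≤upper)
    lower≤τ = proj₁ (proj₂ (separate lower upper lower≤upper))
    τ≤upper = proj₂ (proj₂ (separate lower upper lower≤upper))

    at-τ : ∀ a l → (a ▹ l) ∈ L → Sign a → 0# ≤ a * τ + eval l x t
    at-τ a l al∈L (pos 0<a)  = above-root 0<a (lower≤τ _ (∈-map⁺ rootOf (∈-filter⁺ positive? al∈L 0<a)))
    at-τ a l al∈L (neg a<0)  = below-root a<0 (τ≤upper _ (∈-map⁺ rootOf (∈-filter⁺ negative? al∈L a<0)))
    at-τ a l al∈L (null a≡0) = ≤-trans (sat l (∈-++⁺ˡ (∈-map⁺ rest (∈-filter⁺ zero? al∈L a≡0))))
      (≤-reflexive (sym (trans (cong (λ z → z * τ + eval l x t) a≡0) (trans (cong (_+ eval l x t) (zeroˡ τ)) (+-identityˡ _)))))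

  supremum : ∀ b A → ∃ λ s → b ≤ s × (∀ a → a ∈ A → a ≤ s) × (∀ u → b ≤ u → (∀ a → a ∈ A → a ≤ u) → s ≤ u)
  supremum b []      = b , ≤-refl , (λ _ ()) , λ _ b≤u _ → b≤u
  supremum b (a ∷ A) with s , b≤s , A≤s , least ← supremum b A =
    max s a , ≤-trans b≤s (x≤max s a) ,
    (λ where
      _ (here refl) → y≤max s a
      c (there c∈A) → ≤-trans (A≤s c c∈A) (x≤max s a)) ,
    λ u b≤u A≤u → max-lub (least u b≤u (λ c → A≤u c ∘ there)) (A≤u a (here refl))

  AttainsMinimum : ∀ {k} → List (Affine k) → Set
  AttainsMinimum L = ∃₂ λ x t → Satisfies L x t × (∀ y s → Satisfies L y s → t ≤ s)

  -- The optimum in the absence of variables is the largest of b and the lower bounds on t among the constraints.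
  lp-attains-minimum : ∀ {k} (L : List (Affine k)) b → ∃₂ (Satisfies L) →
    (∀ x t → Satisfies L x t → b ≤ t) → AttainsMinimum L
  lp-attains-minimum {zero} L b (x₀ , t₀ , sat₀) bounded = x₀ , t , sat , optimal
    where
    rootOf : Affine zero → Carrier
    rootOf (base α β) = root α β

    lower = map rootOf (filter positive? L)

    lower≤ : ∀ x s → Satisfies L x s → ∀ r → r ∈ lower → r ≤ s
    lower≤ x s sat _ r∈ with (base α β) , l∈ , refl ← ∈-map⁻ rootOf r∈ with l∈L , 0<α ← ∈-filter⁻ positive? {xs = L} l∈ =
      root≤ 0<α (sat (base α β) l∈L)

    t       = proj₁ (supremum b lower)
    lower≤t = proj₁ (proj₂ (proj₂ (supremum b lower)))
    least   = proj₂ (proj₂ (proj₂ (supremum b lower)))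

    optimal : ∀ y s → Satisfies L y s → t ≤ s
    optimal y s sat = least s (bounded y s sat) (lower≤ y s sat)

    sat : Satisfies L x₀ t
    sat (base α β) l∈L with positive? (base α β)
    ... | yes 0<α = above-root 0<α (lower≤t _ (∈-map⁺ rootOf (∈-filter⁺ positive? l∈L 0<α)))
    -- A constraint with nonpositive coefficient holds at t₀ and survives the descent from t₀ to t.
    ... | no  0≮α = ≤-trans (sat₀ _ l∈L) (≤-by-difference
      (*-nonneg 0≤-α (x≤y⇒0≤y-x (optimal x₀ t₀ sat₀)))
      (solve 4 (λ α β t t₀ → :- α :* (t₀ :- t) := (α :* t :+ β) :- (α :* t₀ :+ β)) refl α β t t₀))
      where
      0≤-α : 0# ≤ - α
      0≤-α with α ≤? 0#
      ... | yes α≤0 = neg-nonneg α≤0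
      ... | no  0<α = contradiction 0<α 0≮α
  -- Elimination projects the feasible set along the first variable and leaves the attainable values
  -- of t unchanged, so an optimum of the projection lifts.
  lp-attains-minimum {suc k} L b (x₀ , t₀ , sat₀) bounded
    with x , t , sat , optimal ← lp-attains-minimum (eliminate L) b
      (x₀ ∘ suc , t₀ , eliminate-sound L x₀ t₀ sat₀)
      (λ x t sat → let τ , sat′ = eliminate-complete L x t sat in bounded (τ ◂ x) t sat′)
    with τ , sat′ ← eliminate-complete L x t sat =
    τ ◂ x , t , sat′ , λ y s sat-y → optimal (y ∘ suc) s (eliminate-sound L y s sat-y)

-- The tropical distance as a maximum of coordinate gaps, and finite sums.

module TropicalDistance (F : OrderedField) where
  open OrderedFieldProperties F
  open TropicalDefs F

  argmax : ∀ {k} (f : Fin (suc k) → Carrier) → ∃ λ j → ∀ i → f i ≤ f j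
  argmax {zero} f = zero , λ { zero → ≤-refl }
  argmax {suc k} f with argmax (f ∘ suc)
  ... | j , f≤fj with f zero ≤? f (suc j)
  ...   | yes f₀≤ = suc j , λ { zero → f₀≤ ; (suc i) → f≤fj i }
  ...   | no  f₀> = zero , λ { zero → ≤-refl ; (suc i) → ≤-trans (f≤fj i) (<⇒≤ f₀>) }

  argmin : ∀ {k} (f : Fin (suc k) → Carrier) → ∃ λ j → ∀ i → f j ≤ f i
  argmin f with j , -f≤-fj ← argmax (-_ ∘ f) = j , λ i → ≤-by-difference (x≤y⇒0≤y-x (-f≤-fj i))
    (solve 2 (λ a b → :- a :- :- b := b :- a) refl (f j) (f i))

  ≤maxOver : ∀ {k} (f : Fin (suc k) → Carrier) j → f j ≤ maxOver f
  ≤maxOver {zero}  f zero    = ≤-refl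
  ≤maxOver {suc k} f zero    = x≤max _ _
  ≤maxOver {suc k} f (suc j) = ≤-trans (≤maxOver (f ∘ suc) j) (y≤max _ _)

  maxOver≤ : ∀ {k} {f : Fin (suc k) → Carrier} {s} → (∀ j → f j ≤ s) → maxOver f ≤ s
  maxOver≤ {zero}  f≤s = f≤s zero
  maxOver≤ {suc k} f≤s = max-lub (f≤s zero) (maxOver≤ (f≤s ∘ suc))

  minOver≤ : ∀ {k} (f : Fin (suc k) → Carrier) j → minOver f ≤ f j
  minOver≤ {zero}  f zero    = ≤-refl
  minOver≤ {suc k} f zero    = min≤x _ _
  minOver≤ {suc k} f (suc j) = ≤-trans (min≤y _ _) (minOver≤ (f ∘ suc) j)

  ≤minOver : ∀ {k} {f : Fin (suc k) → Carrier} {s} → (∀ j → s ≤ f j) → s ≤ minOver f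
  ≤minOver {zero}  s≤f = s≤f zero
  ≤minOver {suc k} s≤f = min-glb (s≤f zero) (≤minOver (s≤f ∘ suc))

  -‿mono-≤ : ∀ {a b c d} → a ≤ b → c ≤ d → a - d ≤ b - c
  -‿mono-≤ {a} {b} {c} {d} a≤b c≤d = ≤-by-difference (+-nonneg (x≤y⇒0≤y-x a≤b) (x≤y⇒0≤y-x c≤d))
    (solve 4 (λ a b c d → (b :- a) :+ (d :- c) := (b :- c) :- (a :- d)) refl a b c d)

  -- dtr y v is the maximum of gap v j k y over all j and k.
  gap : ∀ {m} → Pt m → Fin (suc m) → Fin (suc m) → Pt m → Carrier
  gap v j k y = (y j - v j) - (y k - v k)

  gap≤dtr : ∀ {m} (v : Pt m) j k y → gap v j k y ≤ dtr y v
  gap≤dtr v j k y = -‿mono-≤ (≤maxOver (λ j → y j - v j) j) (minOver≤ (λ k → y k - v k) k)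

  -- The maximum and the minimum are attained, so the distance is itself one of the gaps.
  dtr≤ : ∀ {m} (v y : Pt m) {s} → (∀ j k → gap v j k y ≤ s) → dtr y v ≤ s
  dtr≤ v y gap≤s with j , ≤j ← argmax (λ j → y j - v j) | k , k≤ ← argmin (λ k → y k - v k) =
    ≤-trans (-‿mono-≤ (maxOver≤ ≤j) (≤minOver k≤)) (gap≤s j k)

  dtr-nonneg : ∀ {m} (y v : Pt m) → 0# ≤ dtr y v
  dtr-nonneg y v = ≤-trans (≤-reflexive (sym (-‿inverseʳ _))) (gap≤dtr v zero zero y)

  -- The weight t ranges over all of the field: −ε extends the segment from x to y beyond x.
  mix : ∀ {m} → Carrier → Pt m → Pt m → Pt m
  mix t x y j = (1# - t) * x j + t * y j

  gap-mix : ∀ {m} (v : Pt m) j k t x y → gap v j k (mix t x y) ≡ (1# - t) * gap v j k x + t * gap v j k y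
  gap-mix v j k t x y = solve 7 (λ t xj xk yj yk vj vk →
    (((con (1 , 0) :- t) :* xj :+ t :* yj) :- vj) :- (((con (1 , 0) :- t) :* xk :+ t :* yk) :- vk)
      := (con (1 , 0) :- t) :* ((xj :- vj) :- (xk :- vk)) :+ t :* ((yj :- vj) :- (yk :- vk)))
    refl t (x j) (x k) (y j) (y k) (v j) (v k)

  dtr-convex : ∀ {m} (v x y : Pt m) {t} → 0# ≤ t → 0# ≤ 1# - t →
    dtr (mix t x y) v ≤ (1# - t) * dtr x v + t * dtr y v
  dtr-convex v x y {t} 0≤t 0≤1-t = dtr≤ v (mix t x y) λ j k → ≤-trans (≤-reflexive (gap-mix v j k t x y))
    (+-mono₂-≤ (*-monoˡ-≤ 0≤1-t (gap≤dtr v j k x)) (*-monoˡ-≤ 0≤t (gap≤dtr v j k y)))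

  dtr-extrapolate : ∀ {m} (v x y : Pt m) {ε} → 0# ≤ ε →
    (∀ j k → ε * (dtr y v - gap v j k y) ≤ dtr x v - gap v j k x) →
    dtr (mix (- ε) x y) v ≤ (1# - - ε) * dtr x v + - ε * dtr y v
  dtr-extrapolate v x y {ε} 0≤ε ε≤ = dtr≤ v (mix (- ε) x y) λ j k →
    ≤-trans (≤-reflexive (gap-mix v j k (- ε) x y)) (≤-by-difference
      (+-nonneg (x≤y⇒0≤y-x (ε≤ j k)) (*-nonneg 0≤ε (x≤y⇒0≤y-x (gap≤dtr v j k x))))
      (solve 5 (λ e a b c d → ((a :- c) :- e :* (b :- d)) :+ e :* (a :- c) :=
          ((con (1 , 0) :- (:- e)) :* a :+ :- e :* b) :- ((con (1 , 0) :- (:- e)) :* c :+ :- e :* d))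
        refl ε (dtr x v) (dtr y v) (gap v j k x) (gap v j k y)))

  sumOver-mono : ∀ {n} {a b : Fin n → Carrier} → (∀ i → a i ≤ b i) → sumOver a ≤ sumOver b
  sumOver-mono {zero}  a≤b = ≤-refl
  sumOver-mono {suc n} a≤b = +-mono₂-≤ (a≤b zero) (sumOver-mono (a≤b ∘ suc))

  sumOver-nonneg : ∀ {n} {a : Fin n → Carrier} → (∀ i → 0# ≤ a i) → 0# ≤ sumOver a
  sumOver-nonneg {zero}  0≤a = ≤-refl
  sumOver-nonneg {suc n} 0≤a = +-nonneg (0≤a zero) (sumOver-nonneg (0≤a ∘ suc))

  sumOver-linear : ∀ {n} s t (a b : Fin n → Carrier) →
    sumOver (λ i → s * a i + t * b i) ≡ s * sumOver a + t * sumOver b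
  sumOver-linear {zero}  s t a b = solve 2 (λ s t → con (0 , 0) := s :* con (0 , 0) :+ t :* con (0 , 0)) refl s t
  sumOver-linear {suc n} s t a b = trans (cong (s * a zero + t * b zero +_) (sumOver-linear s t (a ∘ suc) (b ∘ suc)))
    (solve 6 (λ s t a b u v → (s :* a :+ t :* b) :+ (s :* u :+ t :* v) := s :* (a :+ u) :+ t :* (b :+ v))
      refl s t (a zero) (b zero) (sumOver (a ∘ suc)) (sumOver (b ∘ suc)))

  sumOver-tight : ∀ {n} {a b : Fin n → Carrier} → (∀ i → a i ≤ b i) → sumOver b ≤ sumOver a → ∀ i → b i ≤ a i
  sumOver-tight {suc n} {a} {b} a≤b Σb≤Σa zero = ≤-by-difference
    (+-nonneg (x≤y⇒0≤y-x Σb≤Σa) (x≤y⇒0≤y-x (sumOver-mono (a≤b ∘ suc))))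
    (solve 4 (λ a b s t → ((a :+ s) :- (b :+ t)) :+ (t :- s) := a :- b) refl (a zero) (b zero) (sumOver (a ∘ suc)) (sumOver (b ∘ suc)))
  sumOver-tight {suc n} {a} {b} a≤b Σb≤Σa (suc i) = sumOver-tight (a≤b ∘ suc) (≤-by-difference
    (+-nonneg (x≤y⇒0≤y-x Σb≤Σa) (x≤y⇒0≤y-x (a≤b zero)))
    (solve 4 (λ a b s t → ((a :+ s) :- (b :+ t)) :+ (b :- a) := s :- t) refl (a zero) (b zero) (sumOver (a ∘ suc)) (sumOver (b ∘ suc)))) i

module FermatWeber (F : OrderedField) where
  open OrderedFieldProperties F
  open TropicalDefs F
  open LinearProgramming F
  open TropicalDistance F

  cost : ∀ {n m} → (Fin n → Pt m) → Pt m → Carrier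
  cost p y = sumOver (λ i → dtr y (p i))

  gapForm : ∀ {m} → Pt m → Fin (suc m) → Fin (suc m) → Affine (suc m)
  gapForm v j k = (coordinate j ⊖ constant (v j)) ⊖ (coordinate k ⊖ constant (v k))

  eval-gapForm : ∀ {m} (v : Pt m) j k y t → eval (gapForm v j k) y t ≡ gap v j k y
  eval-gapForm v j k y t = trans (eval-⊖ (coordinate j ⊖ constant (v j)) (coordinate k ⊖ constant (v k)) y t) (cong₂ _-_ (side j) (side k))
    where
    side : ∀ j → eval (coordinate j ⊖ constant (v j)) y t ≡ y j - v j
    side j = trans (eval-⊖ (coordinate j) (constant (v j)) y t) (cong₂ _-_ (eval-coordinate j y t) (eval-constant (v j) y t))

  gapForms : ∀ {m} → Pt m → List (Affine (suc m))
  gapForms {m} v = cartesianProductWith (gapForm v) (allFin (suc m)) (allFin (suc m))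

  -- cost p is the maximum of these forms.
  costForms : ∀ {n m} → (Fin n → Pt m) → List (Affine (suc m))
  costForms {zero}  p = constant 0# ∷ []
  costForms {suc n} p = cartesianProductWith _⊕_ (gapForms (p zero)) (costForms (p ∘ suc))

  costForms≤cost : ∀ {n m} (p : Fin n → Pt m) y t l → l ∈ costForms p → eval l y t ≤ cost p y
  costForms≤cost {zero}  p y t _ (here refl) = ≤-reflexive (eval-constant 0# y t)
  costForms≤cost {suc n} p y t _ l∈
    with g , l , g∈ , l∈ , refl ← ∈-cartesianProductWith⁻ _⊕_ (gapForms (p zero)) (costForms (p ∘ suc)) l∈
    with j , k , _ , _ , refl ← ∈-cartesianProductWith⁻ (gapForm (p zero)) (allFin _) (allFin _) g∈ =
    ≤-trans (≤-reflexive (eval-⊕ g l y t)) (+-mono₂-≤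
      (≤-trans (≤-reflexive (eval-gapForm (p zero) j k y t)) (gap≤dtr (p zero) j k y))
      (costForms≤cost (p ∘ suc) y t l l∈))

  cost≤ : ∀ {n m} (p : Fin n → Pt m) y t {s} → (∀ l → l ∈ costForms p → eval l y t ≤ s) → cost p y ≤ s
  cost≤ {zero}  p y t forms≤s = ≤-trans (≤-reflexive (sym (eval-constant 0# y t))) (forms≤s _ (here refl))
  cost≤ {suc n} p y t {s} forms≤s = x≤s-r⇒x+r≤s (dtr≤ (p zero) y λ j k → r≤s-x⇒x≤s-r (cost≤ (p ∘ suc) y t λ l l∈ →
    ≤-by-difference (x≤y⇒0≤y-x (≤-trans (≤-reflexive (sym
        (trans (eval-⊕ (gapForm (p zero) j k) l y t) (cong (_+ eval l y t) (eval-gapForm (p zero) j k y t)))))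
        (forms≤s _ (∈-cartesianProductWith⁺ _⊕_ (∈-cartesianProductWith⁺ (gapForm (p zero)) (∈-allFin j) (∈-allFin k)) l∈))))
      (solve 3 (λ g e s → s :- (g :+ e) := (s :- g) :- e) refl (gap (p zero) j k y) (eval l y t) s)))
    where
    r = cost (p ∘ suc) y
    x≤s-r⇒x+r≤s : ∀ {x} → x ≤ s - r → x + r ≤ s
    x≤s-r⇒x+r≤s {x} x≤s-r = ≤-by-difference (x≤y⇒0≤y-x x≤s-r) (solve 3 (λ x s r → (s :- r) :- x := s :- (x :+ r)) refl x s r)
    r≤s-x⇒x≤s-r : ∀ {x} → r ≤ s - x → x ≤ s - r
    r≤s-x⇒x≤s-r {x} r≤s-x = ≤-by-difference (x≤y⇒0≤y-x r≤s-x) (solve 3 (λ x s r → (s :- x) :- r := (s :- r) :- x) refl x s r)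

  FW-nonempty : ∀ {n m} (p : Fin n → Pt m) → ∃ (FW p)
  FW-nonempty {n} {m} p = x , λ y → ≤-trans (cost≤t x t sat) (optimal y (cost p y) (satisfied y ≤-refl))
    where
    epigraph : List (Affine (suc m))
    epigraph = map (parameter ⊖_) (costForms p)

    satisfied : ∀ y {s} → cost p y ≤ s → Satisfies epigraph y s
    satisfied y {s} cost≤s _ l∈ with l , l∈ , refl ← ∈-map⁻ (parameter ⊖_) l∈ =
      ≤-trans (x≤y⇒0≤y-x (≤-trans (costForms≤cost p y s l l∈) cost≤s))
        (≤-reflexive (sym (trans (eval-⊖ parameter l y s) (cong (_- eval l y s) (eval-parameter y s)))))

    cost≤t : ∀ y s → Satisfies epigraph y s → cost p y ≤ s
    cost≤t y s sat = cost≤ p y s λ l l∈ → 0≤y-x⇒x≤y (≤-trans (sat _ (∈-map⁺ (parameter ⊖_) l∈))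
      (≤-reflexive (trans (eval-⊖ parameter l y s) (cong (_- eval l y s) (eval-parameter y s)))))

    minimum = lp-attains-minimum epigraph 0# ((λ _ → 0#) , _ , satisfied (λ _ → 0#) ≤-refl)
      λ y s sat → ≤-trans (sumOver-nonneg (λ i → dtr-nonneg y (p i))) (cost≤t y s sat)
    x = proj₁ minimum
    t = proj₁ (proj₂ minimum)
    sat = proj₁ (proj₂ (proj₂ minimum))
    optimal = proj₂ (proj₂ (proj₂ minimum))

  module _ {n m} (p : Fin n → Pt m) where

    FW-of-≤ : ∀ {x y} → FW p x → cost p y ≤ cost p x → FW p y
    FW-of-≤ fw cy≤cx z = ≤-trans cy≤cx (fw z)

    Index : Set
    Index = Fin (suc m) × Fin (suc m)

    gapₚ : Fin n → Index → Pt m → Carrier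
    gapₚ i (j , k) = gap (p i) j k

    formₚ : Fin n → Index → Affine (suc m)
    formₚ i (j , k) = gapForm (p i) j k

    Slack : Fin n → Index → Pt m → Set
    Slack i q y = gapₚ i q y < dtr y (p i)

    -- Maximises gapₚ i q′ − gapₚ i q over FW p, with the maximum truncated at 1 to keep the program bounded.
    slack-or-dominates : ∀ {x} → FW p x → ∀ i q q′ →
      (∃ λ y → FW p y × Slack i q y) ⊎ (∀ y → FW p y → gapₚ i q′ y ≤ gapₚ i q y)
    slack-or-dominates {x} fw i q q′ = decide (0# ≤? t)
      where
      gain : Affine (suc m)
      gain = parameter ⊕ (formₚ i q′ ⊖ formₚ i q)

      eval-gain : ∀ y s → eval gain y s ≡ s + (gapₚ i q′ y - gapₚ i q y)
      eval-gain y s = trans (eval-⊕ parameter (formₚ i q′ ⊖ formₚ i q) y s) (cong₂ _+_ (eval-parameter y s)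
        (trans (eval-⊖ (formₚ i q′) (formₚ i q) y s) (cong₂ _-_ (eval-gapForm (p i) _ _ y s) (eval-gapForm (p i) _ _ y s))))

      truncation : Affine (suc m)
      truncation = parameter ⊕ constant 1#

      eval-truncation : ∀ y s → eval truncation y s ≡ s + 1#
      eval-truncation y s = trans (eval-⊕ parameter (constant 1#) y s) (cong₂ _+_ (eval-parameter y s) (eval-constant 1# y s))

      program : List (Affine (suc m))
      program = gain ∷ truncation ∷ map (constant (cost p x) ⊖_) (costForms p)

      eval-sublevel : ∀ l y s → eval (constant (cost p x) ⊖ l) y s ≡ cost p x - eval l y s
      eval-sublevel l y s = trans (eval-⊖ (constant (cost p x)) l y s) (cong (_- eval l y s) (eval-constant (cost p x) y s))

      loss : Pt m → Carrier
      loss y = max (gapₚ i q y - gapₚ i q′ y) (- 1#)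

      satisfied : ∀ y → FW p y → Satisfies program y (loss y)
      satisfied y fw-y _ (here refl) = ≤-trans (x≤y⇒0≤y-x (x≤max (gapₚ i q y - gapₚ i q′ y) (- 1#)))
        (≤-reflexive (trans (solve 3 (λ a b s → s :- (a :- b) := s :+ (b :- a)) refl (gapₚ i q y) (gapₚ i q′ y) (loss y))
          (sym (eval-gain y (loss y)))))
      satisfied y fw-y _ (there (here refl)) = ≤-trans (x≤y⇒0≤y-x (y≤max (gapₚ i q y - gapₚ i q′ y) (- 1#)))
        (≤-reflexive (trans (solve 1 (λ s → s :- (:- con (1 , 0)) := s :+ con (1 , 0)) refl (loss y)) (sym (eval-truncation y (loss y)))))
      satisfied y fw-y _ (there (there l∈)) with l , l∈ , refl ← ∈-map⁻ (constant (cost p x) ⊖_) l∈ =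
        ≤-trans (x≤y⇒0≤y-x (≤-trans (costForms≤cost p y (loss y) l l∈) (fw-y x))) (≤-reflexive (sym (eval-sublevel l y (loss y))))

      minimum = lp-attains-minimum program (- 1#) (x , loss x , satisfied x fw) λ y s sat →
        ≤-by-difference (≤-trans (sat _ (there (here refl))) (≤-reflexive (eval-truncation y s)))
          (solve 1 (λ s → s :+ con (1 , 0) := s :- (:- con (1 , 0))) refl s)
      y = proj₁ minimum
      t = proj₁ (proj₂ minimum)
      sat = proj₁ (proj₂ (proj₂ minimum))
      optimal = proj₂ (proj₂ (proj₂ minimum))

      decide : Dec (0# ≤ t) → (∃ λ y → FW p y × Slack i q y) ⊎ (∀ y → FW p y → gapₚ i q′ y ≤ gapₚ i q y)
      decide (yes 0≤t) = inj₂ λ z fw-z →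
        [ 0≤y-x⇒x≤y , (λ 0≤-1 → contradiction 0≤-1 0≰-1) ]′
          (max-sel (0# ≤_) _ _ (≤-trans 0≤t (optimal z (loss z) (satisfied z fw-z))))
      decide (no t<0) = inj₁ (y , fw-y , λ dtr≤gap → t<0 (≤-by-difference
          (+-nonneg (≤-trans (sat _ (here refl)) (≤-reflexive (eval-gain y t)))
            (x≤y⇒0≤y-x (≤-trans (gap≤dtr (p i) _ _ y) dtr≤gap)))
          (solve 3 (λ t a b → (t :+ (b :- a)) :+ (a :- b) := t :- con (0 , 0)) refl t (gapₚ i q y) (gapₚ i q′ y))))
        where
        fw-y : FW p y
        fw-y = FW-of-≤ {x} {y} fw (cost≤ p y t λ l l∈ → 0≤y-x⇒x≤y (≤-trans
          (sat _ (there (there (∈-map⁺ (constant (cost p x) ⊖_) l∈)))) (≤-reflexive (eval-sublevel l y t))))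

    midpoint : Pt m → Pt m → Pt m
    midpoint = mix ½

    0<1-½ : 0# < 1# - ½
    0<1-½ = subst (0# <_) (sym 1-½≡½) 0<½

    cost-midpoint≤ : ∀ {x y} → FW p x → FW p y → (1# - ½) * cost p x + ½ * cost p y ≤ cost p x
    cost-midpoint≤ {x} {y} fw-x fw-y = ≤-trans (+-mono₂-≤ ≤-refl (*-monoˡ-≤ (<⇒≤ 0<½) (fw-y x)))
      (≤-reflexive (solve 2 (λ h c → (con (1 , 0) :- h) :* c :+ h :* c := c) refl ½ (cost p x)))

    dtr-midpoint : ∀ x y i → dtr (midpoint x y) (p i) ≤ (1# - ½) * dtr x (p i) + ½ * dtr y (p i)
    dtr-midpoint x y i = dtr-convex (p i) x y (<⇒≤ 0<½) (<⇒≤ 0<1-½)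

    FW-midpoint : ∀ {x y} → FW p x → FW p y → FW p (midpoint x y)
    FW-midpoint {x} {y} fw-x fw-y = FW-of-≤ {x} {midpoint x y} fw-x (≤-trans (sumOver-mono (dtr-midpoint x y))
      (≤-trans (≤-reflexive (sumOver-linear (1# - ½) ½ (λ i → dtr x (p i)) (λ i → dtr y (p i)))) (cost-midpoint≤ {x} {y} fw-x fw-y)))

    -- The cost is constant on the segment, so each of its convex summands is affine there.
    dtr-midpoint-tight : ∀ {x y} → FW p x → FW p y → ∀ i →
      (1# - ½) * dtr x (p i) + ½ * dtr y (p i) ≤ dtr (midpoint x y) (p i)
    dtr-midpoint-tight {x} {y} fw-x fw-y = sumOver-tight (dtr-midpoint x y) (≤-trans
      (≤-reflexive (sumOver-linear (1# - ½) ½ (λ i → dtr x (p i)) (λ i → dtr y (p i))))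
      (≤-trans (cost-midpoint≤ {x} {y} fw-x fw-y) (fw-x (midpoint x y))))

    dtr-midpoint≤gap : ∀ {x y} → FW p x → FW p y → ∀ i q → dtr (midpoint x y) (p i) ≤ gapₚ i q (midpoint x y) →
      0# ≤ (1# - ½) * (gapₚ i q x - dtr x (p i)) + ½ * (gapₚ i q y - dtr y (p i))
    dtr-midpoint≤gap {x} {y} fw-x fw-y i q dtr≤gap = ≤-trans
      (x≤y⇒0≤y-x (≤-trans (dtr-midpoint-tight {x} {y} fw-x fw-y i) (≤-trans dtr≤gap (≤-reflexive (gap-mix (p i) _ _ ½ x y)))))
      (≤-reflexive (solve 6 (λ s h a b c d → (s :* a :+ h :* b) :- (s :* c :+ h :* d) := s :* (a :- c) :+ h :* (b :- d))
        refl (1# - ½) ½ (gapₚ i q x) (gapₚ i q y) (dtr x (p i)) (dtr y (p i))))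

    drop-nonpos : ∀ {s h a b} → 0# ≤ h → b ≤ 0# → 0# ≤ s * a + h * b → 0# ≤ s * a
    drop-nonpos {s} {h} {a} {b} 0≤h b≤0 0≤sum = ≤-trans (+-nonneg 0≤sum (*-nonneg 0≤h (neg-nonneg b≤0)))
      (≤-reflexive (solve 4 (λ s h a b → (s :* a :+ h :* b) :+ h :* (:- b) := s :* a) refl s h a b))

    excess≤0 : ∀ i q y → gapₚ i q y - dtr y (p i) ≤ 0#
    excess≤0 i q y = ≤-by-difference (x≤y⇒0≤y-x (gap≤dtr (p i) _ _ y))
      (solve 2 (λ g d → d :- g := con (0 , 0) :- (g :- d)) refl (gapₚ i q y) (dtr y (p i)))

    slack-midpointˡ : ∀ {x y} → FW p x → FW p y → ∀ i q → Slack i q x → Slack i q (midpoint x y)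
    slack-midpointˡ {x} {y} fw-x fw-y i q slack dtr≤gap = slack (0≤y-x⇒x≤y (*-cancel-nonneg 0<1-½
      (drop-nonpos (<⇒≤ 0<½) (excess≤0 i q y) (dtr-midpoint≤gap {x} {y} fw-x fw-y i q dtr≤gap))))

    slack-midpointʳ : ∀ {x y} → FW p x → FW p y → ∀ i q → Slack i q y → Slack i q (midpoint x y)
    slack-midpointʳ {x} {y} fw-x fw-y i q slack dtr≤gap = slack (0≤y-x⇒x≤y (*-cancel-nonneg 0<½
      (drop-nonpos (<⇒≤ 0<1-½) (excess≤0 i q x) (≤-trans (dtr-midpoint≤gap {x} {y} fw-x fw-y i q dtr≤gap)
        (≤-reflexive (solve 4 (λ s h a b → s :* a :+ h :* b := h :* b :+ s :* a) refl (1# - ½) ½ _ _))))))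

    Resolved : Pt m → Fin n × Index × Index → Set
    Resolved x (i , q , q′) = Slack i q x ⊎ (∀ y → FW p y → gapₚ i q′ y ≤ gapₚ i q y)

    refine : ∀ {x τs} → FW p x → All (Resolved x) τs → ∀ i q q′ →
      (∃ λ y → FW p y × Slack i q y) ⊎ (∀ y → FW p y → gapₚ i q′ y ≤ gapₚ i q y) →
      ∃ λ z → FW p z × All (Resolved z) ((i , q , q′) ∷ τs)
    refine {x} fw resolved i q q′ (inj₂ dominates) = x , fw , inj₂ dominates ∷ resolved
    refine {x} fw resolved i q q′ (inj₁ (y , fw-y , slack)) = midpoint x y , FW-midpoint {x} {y} fw fw-y ,
      inj₁ (slack-midpointʳ {x} {y} fw fw-y i q slack) ∷ All.map preserved resolved
      where
      preserved : ∀ {τ} → Resolved x τ → Resolved (midpoint x y) τ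
      preserved {i , q , _} (inj₁ slack)     = inj₁ (slack-midpointˡ {x} {y} fw fw-y i q slack)
      preserved             (inj₂ dominates) = inj₂ dominates

    resolve : ∀ τs → ∃ λ x → FW p x × All (Resolved x) τs
    resolve []                  = let x , fw = FW-nonempty p in x , fw , []
    resolve ((i , q , q′) ∷ τs) = let x , fw , resolved = resolve τs in
      refine {x} fw resolved i q q′ (slack-or-dominates {x} fw i q q′)

    Active : Pt m → Fin n → Index → Set
    Active x i q = dtr x (p i) ≤ gapₚ i q x

    -- Such an x plays the role of a relative interior point of FW p.
    relative-interior : ∃ λ x → FW p x × (∀ i q → Active x i q → ∀ y → FW p y → Active y i q)
    relative-interior = x , fw , λ i q active y fw-y → dtr≤ (p i) y λ j k → dominated active y fw-y
      (All.lookup resolved (∈-cartesianProduct⁺ (∈-allFin i) (∈-cartesianProduct⁺ (∈-indices q) (∈-indices (j , k)))))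
      where
      indices : List Index
      indices = cartesianProduct (allFin (suc m)) (allFin (suc m))

      ∈-indices : ∀ q → q ∈ indices
      ∈-indices (j , k) = ∈-cartesianProduct⁺ (∈-allFin j) (∈-allFin k)

      resolution = resolve (cartesianProduct (allFin n) (cartesianProduct indices indices))
      x = proj₁ resolution
      fw = proj₁ (proj₂ resolution)
      resolved = proj₂ (proj₂ resolution)

      dominated : ∀ {i q q′} → Active x i q → ∀ y → FW p y → Resolved x (i , q , q′) → gapₚ i q′ y ≤ gapₚ i q y
      dominated active y fw-y (inj₁ slack)     = contradiction active slack
      dominated active y fw-y (inj₂ dominates) = dominates y fw-y

    InG×InGbar⇒active : ∀ {x i j k} → InG p x i j → InGbar p x k i → Active x i (j , k)
    InG×InGbar⇒active {x} {i} inG inGbar = dtr≤ (p i) x λ j k → -‿mono-≤ (inG j) (inGbar k)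

    active⇒InG : ∀ {x i j k} → Active x i (j , k) → InG p x i j
    active⇒InG {x} {i} {j} {k} active l = ≤-by-difference (x≤y⇒0≤y-x (≤-trans (gap≤dtr (p i) l k x) active))
      (solve 3 (λ a b c → (a :- c) :- (b :- c) := a :- b) refl (x j - p i j) (x l - p i l) (x k - p i k))

    active⇒InGbar : ∀ {x i j k} → Active x i (j , k) → InGbar p x k i
    active⇒InGbar {x} {i} {j} {k} active l = ≤-by-difference (x≤y⇒0≤y-x (≤-trans (gap≤dtr (p i) j l x) active))
      (solve 3 (λ a b c → (c :- a) :- (c :- b) := b :- a) refl (x k - p i k) (x l - p i l) (x j - p i j))

    InG⇔ : ∀ {y i j} → InG p y i j ⇔ (∀ k → p i j - p i k ≤ y j - y k)
    InG⇔ {y} {i} {j} = mk⇔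
      (λ inG k → ≤-by-difference (x≤y⇒0≤y-x (inG k)) (rearrange k))
      (λ cell k → ≤-by-difference (x≤y⇒0≤y-x (cell k)) (sym (rearrange k)))
      where
      rearrange : ∀ k → (y j - p i j) - (y k - p i k) ≡ (y j - y k) - (p i j - p i k)
      rearrange k = solve 4 (λ a b c d → (a :- b) :- (c :- d) := (a :- c) :- (b :- d)) refl (y j) (p i j) (y k) (p i k)

    InGbar⇔ : ∀ {y i j} → InGbar p y j i ⇔ (∀ k → y j - y k ≤ p i j - p i k)
    InGbar⇔ {y} {i} {j} = mk⇔
      (λ inG k → ≤-by-difference (x≤y⇒0≤y-x (inG k)) (rearrange k))
      (λ cell k → ≤-by-difference (x≤y⇒0≤y-x (cell k)) (sym (rearrange k)))
      where
      rearrange : ∀ k → (y k - p i k) - (y j - p i j) ≡ (p i j - p i k) - (y j - y k)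
      rearrange k = solve 4 (λ a b c d → (c :- d) :- (a :- b) := (b :- d) :- (a :- c)) refl (y j) (p i j) (y k) (p i k)

module Cells (F : OrderedField) where
  open OrderedFieldProperties F
  open TropicalDefs F
  open TropicalDistance F
  open FermatWeber F

  ≤-swap : ∀ {a b c d} → a - b ≤ c - d → d - c ≤ b - a
  ≤-swap {a} {b} {c} {d} a-b≤c-d = ≤-by-difference (x≤y⇒0≤y-x a-b≤c-d)
    (solve 4 (λ a b c d → (c :- d) :- (a :- b) := (b :- a) :- (d :- c)) refl a b c d)

  HalfSpace : ∀ {m} → Fin (suc m) → Fin (suc m) → Carrier → Subset m
  HalfSpace j k c y = c ≤ y j - y k

  halfSpace-convex : ∀ {m} (j k : Fin (suc m)) c → IsClassicallyConvex (HalfSpace j k c)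
  halfSpace-convex j k c u v u∈ v∈ t 0≤t t≤1 = ≤-by-difference
    (+-nonneg (*-nonneg 0≤t (x≤y⇒0≤y-x u∈)) (*-nonneg (x≤y⇒0≤y-x t≤1) (x≤y⇒0≤y-x v∈)))
    (trans
      (solve 4 (λ t c a b → t :* (a :- c) :+ (con (1 , 0) :- t) :* (b :- c) := (t :* a :+ (con (1 , 0) :- t) :* b) :- c)
        refl t c (u j - u k) (v j - v k))
      (cong (_- c) (trans
        (cong₂ (λ a b → t * a + (1# - t) * b) (sym (normalized u)) (sym (normalized v)))
        (solve 6 (λ t s a a′ b b′ → t :* (a :- a′) :+ s :* (b :- b′) := (t :* a :+ s :* b) :- (t :* a′ :+ s :* b′))
          refl t (1# - t) (normalize u j) (normalize u k) (normalize v j) (normalize v k)))))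
    where
    normalized : ∀ w → normalize w j - normalize w k ≡ w j - w k
    normalized w = solve 3 (λ a b o → (a :- o) :- (b :- o) := a :- b) refl (w j) (w k) (w zero)

  halfSpace-tropicallyConvex : ∀ {m} (j k : Fin (suc m)) c → IsTropicallyConvex (HalfSpace j k c)
  halfSpace-tropicallyConvex j k c u v u∈ v∈ a b = ≤-by-difference
    (x≤y⇒0≤y-x (max-lub (shift a u u∈ (x≤max (a + u j) (b + v j))) (shift b v v∈ (y≤max (a + u j) (b + v j)))))
    (solve 3 (λ M N c → (M :- c) :- N := (M :- N) :- c) refl (tmax a u b v j) (tmax a u b v k) c)
    where
    shift : ∀ a w → HalfSpace j k c w → ∀ {M} → a + w j ≤ M → a + w k ≤ M - c
    shift a w w∈ {M} ≤M = ≤-by-difference (+-nonneg (x≤y⇒0≤y-x ≤M) (x≤y⇒0≤y-x w∈))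
      (solve 5 (λ a x y M c → (M :- (a :+ x)) :+ ((x :- y) :- c) := (M :- c) :- (a :+ y)) refl a (w j) (w k) M c)

  cell-convex : ∀ {n m} (p : Fin n → Pt m) x → IsClassicallyConvex (Cell p x)
  cell-convex p x u v (u≥ , u≤) (v≥ , v≤) t 0≤t t≤1 =
    (λ i j inG k → halfSpace-convex j k _ u v (u≥ i j inG k) (v≥ i j inG k) t 0≤t t≤1) ,
    (λ j i inG k → ≤-swap (halfSpace-convex k j _ u v (≤-swap (u≤ j i inG k)) (≤-swap (v≤ j i inG k)) t 0≤t t≤1))

  cell-tropicallyConvex : ∀ {n m} (p : Fin n → Pt m) x → IsTropicallyConvex (Cell p x)
  cell-tropicallyConvex p x u v (u≥ , u≤) (v≥ , v≤) a b =
    (λ i j inG k → halfSpace-tropicallyConvex j k _ u v (u≥ i j inG k) (v≥ i j inG k) a b) ,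
    (λ j i inG k → ≤-swap (halfSpace-tropicallyConvex k j _ u v (≤-swap (u≤ j i inG k)) (≤-swap (v≤ j i inG k)) a b))

  small-multiple : ∀ {A : Set} (δ D : A → Carrier) → (∀ τ → 0# ≤ δ τ) → (∀ τ → 0# ≤ D τ) →
    (∀ τ → δ τ ≤ 0# → D τ ≤ 0#) → ∀ τs → ∃ λ ε → 0# < ε × (∀ τ → τ ∈ τs → ε * D τ ≤ δ τ)
  small-multiple δ D 0≤δ 0≤D vanish []       = 1# , 0<1 , λ _ ()
  small-multiple δ D 0≤δ 0≤D vanish (τ ∷ τs) with single (D τ ≤? 0#) | small-multiple δ D 0≤δ 0≤D vanish τs
    where
    single : Dec (D τ ≤ 0#) → ∃ λ ε → 0# < ε × ε * D τ ≤ δ τ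
    single (yes D≤0) = 1# , 0<1 , ≤-trans (≤-reflexive (*-identityˡ _)) (≤-trans D≤0 (0≤δ τ))
    single (no  0<D) = δ τ * inv (D τ) ,
      (λ ε≤0 → 0<D (vanish τ (≤-trans (≤-reflexive (sym cancel)) (≤-by-difference
        (*-nonneg (0≤D τ) (neg-nonneg ε≤0)) (solve 2 (λ d e → d :* (:- e) := con (0 , 0) :- e :* d) refl (D τ) (δ τ * inv (D τ))))))) ,
      ≤-reflexive cancel
      where
      cancel : δ τ * inv (D τ) * D τ ≡ δ τ
      cancel = trans (solve 3 (λ a i d → a :* i :* d := a :* (d :* i)) refl (δ τ) (inv (D τ)) (D τ))
        (trans (cong (δ τ *_) (*-inv (0<⇒≢0 0<D))) (*-identityʳ _))
  ... | ε₁ , 0<ε₁ , ε₁D≤δ | ε₂ , 0<ε₂ , ε₂D≤δ = min ε₁ ε₂ , min-pos 0<ε₁ 0<ε₂ , λ where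
      _ (here refl) → ≤-trans (scale (min≤x ε₁ ε₂) (0≤D τ)) ε₁D≤δ
      σ (there σ∈)  → ≤-trans (scale (min≤y ε₁ ε₂) (0≤D σ)) (ε₂D≤δ σ σ∈)
    where
    scale : ∀ {a b d} → a ≤ b → 0# ≤ d → a * d ≤ b * d
    scale {a} {b} {d} a≤b 0≤d = subst₂ _≤_ (*-comm d a) (*-comm d b) (*-monoˡ-≤ 0≤d a≤b)

  module _ {n m} (p : Fin n → Pt m) where

    cell⇒active : ∀ {x y} → Cell p x y → ∀ i q → Active p x i q → Active p y i q
    cell⇒active {x} {y} (≥cell , ≤cell) i (j , k) active = InG×InGbar⇒active p {y} {i} {j} {k}
      (Equivalence.from (InG⇔ p {y}) (≥cell i j (active⇒InG p {x} {i} {j} {k} active)))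
      (Equivalence.from (InGbar⇔ p {y}) (≤cell k i (active⇒InGbar p {x} {i} {j} {k} active)))

    active⇒cell : ∀ {x y} → (∀ i q → Active p x i q → Active p y i q) → Cell p x y
    active⇒cell {x} {y} incl =
      (λ i j inG → let k , inGbar = argmin (λ k → x k - p i k) in
        Equivalence.to (InG⇔ p {y}) (active⇒InG p {y} {i} {j} {k}
          (incl i (j , k) (InG×InGbar⇒active p {x} {i} {j} {k} inG inGbar)))) ,
      (λ k i inGbar → let j , inG = argmax (λ j → x j - p i j) in
        Equivalence.to (InGbar⇔ p {y}) (active⇒InGbar p {y} {i} {j} {k}
          (incl i (j , k) (InG×InGbar⇒active p {x} {i} {j} {k} inG inGbar))))

    -- Beyond x, on the line from y through x, the cost is still affine; as it is minimal at x, it is constant.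
    FW-extrapolate : ∀ {x y ε} → FW p x → 0# < ε →
      (∀ i j k → ε * (dtr y (p i) - gap (p i) j k y) ≤ dtr x (p i) - gap (p i) j k x) → FW p y
    FW-extrapolate {x} {y} {ε} fw 0<ε ε≤ = FW-of-≤ p {x} {y} fw (*-cancelˡ-≤ 0<ε (≤-by-difference
      (x≤y⇒0≤y-x (≤-trans (fw (mix (- ε) x y)) (≤-trans
        (sumOver-mono (λ i → dtr-extrapolate (p i) x y (<⇒≤ 0<ε) (ε≤ i)))
        (≤-reflexive (sumOver-linear (1# - - ε) (- ε) (λ i → dtr x (p i)) (λ i → dtr y (p i)))))))
      (solve 3 (λ e a b → (con (1 , 0) :- (:- e)) :* a :+ :- e :* b :- a := e :* a :- e :* b) refl ε (cost p x) (cost p y))))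

    active⇒FW : ∀ {x y} → FW p x → (∀ i q → Active p x i q → Active p y i q) → FW p y
    active⇒FW {x} {y} fw incl =
      let ε , 0<ε , ε≤ = small-multiple (slack x) (slack y) (0≤slack x) (0≤slack y)
            (λ (i , q) slack≤0 → ≤⇒-≤0 (incl i q (-≤0⇒≤ slack≤0)))
            (cartesianProduct (allFin n) (cartesianProduct (allFin (suc m)) (allFin (suc m))))
      in FW-extrapolate {x} {y} fw 0<ε λ i j k →
        ε≤ (i , j , k) (∈-cartesianProduct⁺ (∈-allFin i) (∈-cartesianProduct⁺ (∈-allFin j) (∈-allFin k)))
      where
      slack : Pt m → Fin n × Index p → Carrier
      slack w (i , q) = dtr w (p i) - gapₚ p i q w

      0≤slack : ∀ w τ → 0# ≤ slack w τ
      0≤slack w (i , j , k) = x≤y⇒0≤y-x (gap≤dtr (p i) j k w)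

      -≤0⇒≤ : ∀ {a b} → a - b ≤ 0# → a ≤ b
      -≤0⇒≤ {a} {b} a-b≤0 = ≤-by-difference (neg-nonneg a-b≤0) (solve 2 (λ a b → :- (a :- b) := b :- a) refl a b)

      ≤⇒-≤0 : ∀ {a b} → a ≤ b → a - b ≤ 0#
      ≤⇒-≤0 {a} {b} a≤b = ≤-by-difference (x≤y⇒0≤y-x a≤b) (solve 2 (λ a b → b :- a := con (0 , 0) :- (a :- b)) refl a b)

    FW-is-cell : ∃ λ x → ∀ y → FW p y ⇔ Cell p x y
    FW-is-cell = let x , fw , minimal = relative-interior p in x , λ y → mk⇔
      (λ fw-y → active⇒cell {x} {y} λ i q active → minimal i q active y fw-y)
      (λ cell → active⇒FW {x} {y} fw (cell⇒active {x} {y} cell))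

    FW-polytrope : IsPolytrope (FW p)
    FW-polytrope =
      (λ u v fw-u fw-v t 0≤t t≤1 → from _ (cell-convex p x u v (to u fw-u) (to v fw-v) t 0≤t t≤1)) ,
      (λ u v fw-u fw-v a b → from _ (cell-tropicallyConvex p x u v (to u fw-u) (to v fw-v) a b))
      where
      x = proj₁ FW-is-cell

      to : ∀ y → FW p y → Cell p x y
      to y = Equivalence.to (proj₂ FW-is-cell y)

      from : ∀ y → Cell p x y → FW p y
      from y = Equivalence.from (proj₂ FW-is-cell y)

theorem1 : (F : OrderedField) → let open TropicalDefs F in
    (n m : ℕ) (p : Fin n → Pt m) →
    IsPolytrope (FW p) × Σ (Pt m) (λ x → ∀ y → FW p y ⇔ Cell p x y)
theorem1 F n m p = Cells.FW-polytrope F p , Cells.FW-is-cell F p
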